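{- Let $Sp(K,S)$ be a split graph with biadjacency matrix $R$, and let $G$ be a graph (disjoint from $Sp$). Then \[\mathcal{N}(Sp\circ G)\supseteq\{(0,z,0)^t: z\in\mathcal{N}(R)\},\] where vectors indexed by $V(Sp\circ G)$ are written in blocks according to the ordering $(K,S,V(G))$. In particular, if $\mathcal{N}(R)\ne\{0\}$, then $Sp\circ G$ is singular.
   Context: Graphs are finite and simple. A split graph is a graph $Sp$ whose vertex set is a disjoint union of a clique $K$ and an independent set $S$; the pair $(K,S)$ is called an s-partition, and $Sp(K,S)$ denotes $Sp$ together with this s-partition. Both $K$ and $S$ are assumed nonempty. $R$ is the $|K|\times|S|$ $0/1$ biadjacency matrix ($R_{uv}=1$ iff $u\in K$ and $v\in S$ are adjacent). $\mathcal{N}$ denotes the nullspace of a real matrix, and for a graph the nullspace of its adjacency matrix; a graph is singular if its adjacency matrix is singular. For a split graph $Sp(K,S)$ and a graph $G$ disjoint from it, the Tyshkevich composition $Sp\circ G$ is the graph with vertex set $V(Sp)\cup V(G)$ and edge set $E(Sp)\cup E(G)\cup\{xy: x\in K,\ y\in V(G)\}$. -}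

module Defs where

open import Level using (Level; 0ℓ)
open import Algebra.Bundles using (CommutativeRing)
import Algebra.Definitions.RawMonoid as RawMonoidDefs
open import Data.Bool.Base using (if_then_else_)
open import Data.Fin.Base as Fin using (Fin; splitAt; _↑ˡ_; _↑ʳ_)
import Data.Fin.Properties as Fin
open import Data.Nat.Base as ℕ using (ℕ)
import Data.Nat.Properties as ℕ
open import Data.Product.Base using (∃; ∃-syntax; _×_; _,_)
open import Data.Rational.Base
  using (ℚ; 0ℚ; 1ℚ; ½; _+_; _-_; _*_; -_; 1/_; ∣_∣; _≤_; _<_; positive)
open import Data.Rational.Properties
open import Data.Rational.Solver using (module +-*-Solver)
open import Data.Sum.Base using (_⊎_; inj₁; inj₂)
open import Data.Vec.Functional using (Vector; replicate; _++_)
import Data.Vec.Functional.Relation.Binary.Equality.Setoid as VecEquality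
open import Relation.Binary.Definitions using (Symmetric; Irreflexive; Decidable)
open import Relation.Binary.Core using (Rel)
open import Relation.Binary.PropositionalEquality
  using (_≡_; _≢_; refl; sym; trans; cong; subst)
open import Relation.Nullary using (¬_; does)
open import Relation.Unary using (Pred)

-- The real numbers: Cauchy sequences of rationals, two sequences being
-- equal when their difference tends to 0.  The ring operations are
-- pointwise.

IsCauchy : (ℕ → ℚ) → Set
IsCauchy x = ∀ ε → 0ℚ < ε →
  ∃[ N ] ∀ m n → N ℕ.≤ m → N ℕ.≤ n → ∣ x m - x n ∣ < ε

record ℝ : Set where
  constructor mkℝ
  field
    seq    : ℕ → ℚ
    cauchy : IsCauchy seq

open ℝ public

infix 4 _≈ᴿ_

_≈ᴿ_ : ℝ → ℝ → Set
x ≈ᴿ y = ∀ ε → 0ℚ < ε → ∃[ N ] ∀ n → N ℕ.≤ n → ∣ seq x n - seq y n ∣ < ε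

private
  half : ∀ {ε} → 0ℚ < ε → ∃[ δ ] 0ℚ < δ × δ + δ ≡ ε
  half {ε} 0<ε = ½ * ε
    , positive⁻¹ (½ * ε) {{pos*pos⇒pos ½ ε {{positive 0<ε}}}}
    , trans (sym (*-distribʳ-+ ε ½ ½)) (*-identityˡ ε)

  quotient : ∀ {C ε} → 0ℚ < C → 0ℚ < ε → ∃[ δ ] 0ℚ < δ × C * δ ≡ ε
  quotient {C} {ε} 0<C 0<ε = C⁻¹ * ε
    , positive⁻¹ (C⁻¹ * ε) {{pos*pos⇒pos C⁻¹ {{1/pos⇒pos C}} ε}}
    , trans (sym (*-assoc C C⁻¹ ε))
        (trans (cong (_* ε) (*-inverseʳ C)) (*-identityˡ ε))
    where
    instance
      _ = positive 0<C
      _ = positive 0<ε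
      _ = pos⇒nonZero C
    C⁻¹ = 1/ C

  0≤∣_∣ : ∀ p → 0ℚ ≤ ∣ p ∣
  0≤∣ p ∣ = nonNegative⁻¹ ∣ p ∣ {{∣-∣-nonNeg p}}

  ∣p-p∣≡0 : ∀ p → ∣ p - p ∣ ≡ 0ℚ
  ∣p-p∣≡0 p = cong ∣_∣ (+-inverseʳ p)

  ∣-∣-swap : ∀ p q → ∣ p - q ∣ ≡ ∣ q - p ∣
  ∣-∣-swap p q = trans
    (cong ∣_∣ (solve 2 (λ p q → p :- q := :- (q :- p)) refl p q))
    (∣-p∣≡∣p∣ (q - p))
    where open +-*-Solver

  ∣+∣-< : ∀ p q {α β} → ∣ p ∣ < α → ∣ q ∣ < β → ∣ p + q ∣ < α + β
  ∣+∣-< p q p<α q<β = ≤-<-trans (∣p+q∣≤∣p∣+∣q∣ p q) (+-mono-< p<α q<β)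

  sum-close : ∀ a a′ b b′ {δ ε} → δ + δ ≡ ε →
              ∣ a - a′ ∣ < δ → ∣ b - b′ ∣ < δ →
              ∣ (a + b) - (a′ + b′) ∣ < ε
  sum-close a a′ b b′ δ+δ≡ε aa bb =
    subst (∣ (a + b) - (a′ + b′) ∣ <_) δ+δ≡ε
      (subst (λ t → ∣ t ∣ < _)
        (solve 4 (λ a a′ b b′ → (a :- a′) :+ (b :- b′) := (a :+ b) :- (a′ :+ b′))
          refl a a′ b b′)
        (∣+∣-< (a - a′) (b - b′) aa bb))
    where open +-*-Solver

  ∣*∣-< : ∀ p q {α β} → ∣ p ∣ < α → ∣ q ∣ < β → ∣ p * q ∣ < α * β
  ∣*∣-< p q {α} {β} p<α q<β = begin-strict
    ∣ p * q ∣       ≡⟨ ∣p*q∣≡∣p∣*∣q∣ p q ⟩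
    ∣ p ∣ * ∣ q ∣   ≤⟨ *-monoʳ-≤-nonNeg ∣ q ∣ {{∣-∣-nonNeg q}} (<⇒≤ p<α) ⟩
    α * ∣ q ∣       <⟨ *-monoʳ-<-pos α {{positive (≤-<-trans 0≤∣ p ∣ p<α)}} q<β ⟩
    α * β           ∎
    where open ≤-Reasoning

  product-close : ∀ a a′ b b′ {A B δ ε} → (A + B) * δ ≡ ε →
                  ∣ a ∣ < A → ∣ b′ ∣ < B →
                  ∣ a - a′ ∣ < δ → ∣ b - b′ ∣ < δ →
                  ∣ (a * b) - (a′ * b′) ∣ < ε
  product-close a a′ b b′ {A} {B} {δ} eq a<A b′<B aa bb =
    subst (∣ (a * b) - (a′ * b′) ∣ <_)
      (trans (solve 3 (λ A B δ → A :* δ :+ B :* δ := (A :+ B) :* δ) refl A B δ) eq)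
      (subst (λ t → ∣ t ∣ < _)
        (solve 4 (λ a a′ b b′ →
            a :* (b :- b′) :+ b′ :* (a :- a′) := (a :* b) :- (a′ :* b′))
          refl a a′ b b′)
        (∣+∣-< (a * (b - b′)) (b′ * (a - a′))
          (∣*∣-< a (b - b′) a<A bb) (∣*∣-< b′ (a - a′) b′<B aa)))
    where open +-*-Solver

  bounded : ∀ (x : ℝ) → ∃[ B ] 0ℚ < B × ∃[ N ] ∀ n → N ℕ.≤ n → ∣ seq x n ∣ < B
  bounded x with cauchy x 1ℚ (positive⁻¹ 1ℚ)
  ... | N , close = 1ℚ + ∣ seq x N ∣
      , +-mono-<-≤ (positive⁻¹ 1ℚ) 0≤∣ seq x N ∣
      , N , λ n N≤n → subst (λ t → ∣ t ∣ < 1ℚ + ∣ seq x N ∣)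
          (solve 2 (λ p q → (p :- q) :+ q := p) refl (seq x n) (seq x N))
          (≤-<-trans (∣p+q∣≤∣p∣+∣q∣ (seq x n - seq x N) (seq x N))
            (+-mono-<-≤ (close n N N≤n ℕ.≤-refl) ≤-refl))
    where open +-*-Solver

  ⊔-boundˡ : ∀ {M N n} → M ℕ.⊔ N ℕ.≤ n → M ℕ.≤ n
  ⊔-boundˡ {M} {N} = ℕ.m⊔n≤o⇒m≤o M N

  ⊔-boundʳ : ∀ {M N n} → M ℕ.⊔ N ℕ.≤ n → N ℕ.≤ n
  ⊔-boundʳ {M} {N} = ℕ.m⊔n≤o⇒n≤o M N

  pointwise : ∀ {x y} → (∀ n → seq x n ≡ seq y n) → x ≈ᴿ y
  pointwise {x} {y} eq ε 0<ε = 0 , λ n _ →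
    subst (_< ε) (sym (trans (cong (λ t → ∣ t - seq y n ∣) (eq n)) (∣p-p∣≡0 (seq y n)))) 0<ε

fromℚ : ℚ → ℝ
fromℚ q = mkℝ (λ _ → q) λ ε 0<ε →
  0 , λ _ _ _ _ → subst (_< ε) (sym (∣p-p∣≡0 q)) 0<ε

0ᴿ 1ᴿ : ℝ
0ᴿ = fromℚ 0ℚ
1ᴿ = fromℚ 1ℚ

infixl 6 _+ᴿ_
infixl 7 _*ᴿ_
infix  8 -ᴿ_

_+ᴿ_ : ℝ → ℝ → ℝ
seq (x +ᴿ y) n = seq x n + seq y n
cauchy (x +ᴿ y) ε 0<ε =
  let δ , 0<δ , δ+δ≡ε = half 0<ε
      M , closeˣ = cauchy x δ 0<δ
      N , closeʸ = cauchy y δ 0<δ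
  in M ℕ.⊔ N , λ m n ≤m ≤n →
       sum-close (seq x m) (seq x n) (seq y m) (seq y n) δ+δ≡ε
         (closeˣ m n (⊔-boundˡ ≤m) (⊔-boundˡ ≤n))
         (closeʸ m n (⊔-boundʳ {M} ≤m) (⊔-boundʳ {M} ≤n))

-ᴿ_ : ℝ → ℝ
seq (-ᴿ x) n = - seq x n
cauchy (-ᴿ x) ε 0<ε =
  let N , close = cauchy x ε 0<ε
  in N , λ m n ≤m ≤n →
       subst (λ t → ∣ t ∣ < ε)
         (solve 2 (λ p q → q :- p := :- p :- (:- q)) refl (seq x m) (seq x n))
         (close n m ≤n ≤m)
  where open +-*-Solver

_*ᴿ_ : ℝ → ℝ → ℝ
seq (x *ᴿ y) n = seq x n * seq y n
cauchy (x *ᴿ y) ε 0<ε =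
  let A , 0<A , K , ∣x∣<A = bounded x
      B , 0<B , L , ∣y∣<B = bounded y
      δ , 0<δ , eq = quotient (+-mono-< 0<A 0<B) 0<ε
      M , closeˣ = cauchy x δ 0<δ
      N , closeʸ = cauchy y δ 0<δ
  in (K ℕ.⊔ L) ℕ.⊔ (M ℕ.⊔ N) , λ m n ≤m ≤n →
       let KL≤m = ⊔-boundˡ ≤m
           KL≤n = ⊔-boundˡ ≤n
           MN≤m = ⊔-boundʳ {K ℕ.⊔ L} ≤m
           MN≤n = ⊔-boundʳ {K ℕ.⊔ L} ≤n
       in product-close (seq x m) (seq x n) (seq y m) (seq y n) eq
            (∣x∣<A m (⊔-boundˡ KL≤m)) (∣y∣<B n (⊔-boundʳ {K} KL≤n))
            (closeˣ m n (⊔-boundˡ MN≤m) (⊔-boundˡ MN≤n))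
            (closeʸ m n (⊔-boundʳ {M} MN≤m) (⊔-boundʳ {M} MN≤n))

private
  ≈ᴿ-refl : ∀ {x} → x ≈ᴿ x
  ≈ᴿ-refl {x} = pointwise {x} {x} λ _ → refl

  ≈ᴿ-sym : ∀ {x y} → x ≈ᴿ y → y ≈ᴿ x
  ≈ᴿ-sym {x} {y} x≈y ε 0<ε =
    let N , close = x≈y ε 0<ε
    in N , λ n ≤n → subst (_< ε) (∣-∣-swap (seq x n) (seq y n)) (close n ≤n)

  ≈ᴿ-trans : ∀ {x y z} → x ≈ᴿ y → y ≈ᴿ z → x ≈ᴿ z
  ≈ᴿ-trans {x} {y} {z} x≈y y≈z ε 0<ε =
    let δ , 0<δ , δ+δ≡ε = half 0<ε
        M , close₁ = x≈y δ 0<δ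
        N , close₂ = y≈z δ 0<δ
    in M ℕ.⊔ N , λ n ≤n →
         subst (∣ seq x n - seq z n ∣ <_) δ+δ≡ε
           (subst (λ t → ∣ t ∣ < δ + δ)
             (solve 3 (λ p q r → (p :- q) :+ (q :- r) := p :- r)
               refl (seq x n) (seq y n) (seq z n))
             (∣+∣-< (seq x n - seq y n) (seq y n - seq z n)
               (close₁ n (⊔-boundˡ ≤n)) (close₂ n (⊔-boundʳ {M} ≤n))))
    where open +-*-Solver

  +ᴿ-cong : ∀ {x x′ y y′} → x ≈ᴿ x′ → y ≈ᴿ y′ → x +ᴿ y ≈ᴿ x′ +ᴿ y′
  +ᴿ-cong {x} {x′} {y} {y′} x≈ y≈ ε 0<ε =
    let δ , 0<δ , δ+δ≡ε = half 0<ε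
        M , closeˣ = x≈ δ 0<δ
        N , closeʸ = y≈ δ 0<δ
    in M ℕ.⊔ N , λ n ≤n →
         sum-close (seq x n) (seq x′ n) (seq y n) (seq y′ n) δ+δ≡ε
           (closeˣ n (⊔-boundˡ ≤n)) (closeʸ n (⊔-boundʳ {M} ≤n))

  -ᴿ-cong : ∀ {x x′} → x ≈ᴿ x′ → -ᴿ x ≈ᴿ -ᴿ x′
  -ᴿ-cong {x} {x′} x≈ ε 0<ε =
    let N , close = ≈ᴿ-sym {x} {x′} x≈ ε 0<ε
    in N , λ n ≤n →
         subst (λ t → ∣ t ∣ < ε)
           (solve 2 (λ p q → q :- p := :- p :- (:- q)) refl (seq x n) (seq x′ n))
           (close n ≤n)
    where open +-*-Solver

  *ᴿ-cong : ∀ {x x′ y y′} → x ≈ᴿ x′ → y ≈ᴿ y′ → x *ᴿ y ≈ᴿ x′ *ᴿ y′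
  *ᴿ-cong {x} {x′} {y} {y′} x≈ y≈ ε 0<ε =
    let A , 0<A , K , ∣x∣<A = bounded x
        B , 0<B , L , ∣y′∣<B = bounded y′
        δ , 0<δ , eq = quotient (+-mono-< 0<A 0<B) 0<ε
        M , closeˣ = x≈ δ 0<δ
        N , closeʸ = y≈ δ 0<δ
    in (K ℕ.⊔ L) ℕ.⊔ (M ℕ.⊔ N) , λ n ≤n →
         let KL≤n = ⊔-boundˡ ≤n
             MN≤n = ⊔-boundʳ {K ℕ.⊔ L} ≤n
         in product-close (seq x n) (seq x′ n) (seq y n) (seq y′ n) eq
              (∣x∣<A n (⊔-boundˡ KL≤n)) (∣y′∣<B n (⊔-boundʳ {K} KL≤n))
              (closeˣ n (⊔-boundˡ MN≤n)) (closeʸ n (⊔-boundʳ {M} MN≤n))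

ℝ-commutativeRing : CommutativeRing 0ℓ 0ℓ
ℝ-commutativeRing = record
  { Carrier = ℝ
  ; _≈_ = _≈ᴿ_
  ; _+_ = _+ᴿ_
  ; _*_ = _*ᴿ_
  ; -_ = -ᴿ_
  ; 0# = 0ᴿ
  ; 1# = 1ᴿ
  ; isCommutativeRing = record
    { isRing = record
      { +-isAbelianGroup = record
        { isGroup = record
          { isMonoid = record
            { isSemigroup = record
              { isMagma = record
                { isEquivalence = record
                  { refl = λ {x} → ≈ᴿ-refl {x}
                  ; sym = λ {x y} → ≈ᴿ-sym {x} {y}
                  ; trans = λ {x y z} → ≈ᴿ-trans {x} {y} {z}
                  }
                ; ∙-cong = λ {x x′ y y′} → +ᴿ-cong {x} {x′} {y} {y′}
                }
              ; assoc = λ x y z → pointwise {(x +ᴿ y) +ᴿ z} {x +ᴿ (y +ᴿ z)}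
                  λ n → +-assoc (seq x n) (seq y n) (seq z n)
              }
            ; identity =
                (λ x → pointwise {0ᴿ +ᴿ x} {x} λ n → +-identityˡ (seq x n))
              , (λ x → pointwise {x +ᴿ 0ᴿ} {x} λ n → +-identityʳ (seq x n))
            }
          ; inverse =
              (λ x → pointwise {(-ᴿ x) +ᴿ x} {0ᴿ} λ n → +-inverseˡ (seq x n))
            , (λ x → pointwise {x +ᴿ (-ᴿ x)} {0ᴿ} λ n → +-inverseʳ (seq x n))
          ; ⁻¹-cong = λ {x x′} → -ᴿ-cong {x} {x′}
          }
        ; comm = λ x y → pointwise {x +ᴿ y} {y +ᴿ x} λ n → +-comm (seq x n) (seq y n)
        }
      ; *-cong = λ {x x′ y y′} → *ᴿ-cong {x} {x′} {y} {y′}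
      ; *-assoc = λ x y z → pointwise {(x *ᴿ y) *ᴿ z} {x *ᴿ (y *ᴿ z)}
          λ n → *-assoc (seq x n) (seq y n) (seq z n)
      ; *-identity =
          (λ x → pointwise {1ᴿ *ᴿ x} {x} λ n → *-identityˡ (seq x n))
        , (λ x → pointwise {x *ᴿ 1ᴿ} {x} λ n → *-identityʳ (seq x n))
      ; distrib =
          (λ x y z → pointwise {x *ᴿ (y +ᴿ z)} {x *ᴿ y +ᴿ x *ᴿ z}
            λ n → *-distribˡ-+ (seq x n) (seq y n) (seq z n))
        , (λ x y z → pointwise {(y +ᴿ z) *ᴿ x} {y *ᴿ x +ᴿ z *ᴿ x}
            λ n → *-distribʳ-+ (seq x n) (seq y n) (seq z n))
      }
    ; *-comm = λ x y → pointwise {x *ᴿ y} {y *ᴿ x} λ n → *-comm (seq x n) (seq y n)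
    }
  }

record Graph (n : ℕ) : Set₁ where
  field
    Adj    : Rel (Fin n) 0ℓ
    adj?   : Decidable Adj
    symm   : Symmetric Adj
    irrefl : Irreflexive _≡_ Adj

-- A split graph with an s-partition (K,S), |K| = k and |S| = s.  The
-- vertices are listed with K first: the elements of K are the i ↑ˡ s
-- and the elements of S are the k ↑ʳ j.

record SplitGraph (k s : ℕ) : Set₁ where
  field
    graph       : Graph (k ℕ.+ s)
    clique      : ∀ {i j : Fin k} → i ≢ j → Graph.Adj graph (i ↑ˡ s) (j ↑ˡ s)
    independent : ∀ (i j : Fin s) → ¬ Graph.Adj graph (k ↑ʳ i) (k ↑ʳ j)
    K-nonempty  : ℕ.NonZero k
    S-nonempty  : ℕ.NonZero s

  open Graph graph public

  InK : Pred (Fin (k ℕ.+ s)) 0ℓ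
  InK v = ∃[ i ] v ≡ i ↑ˡ s

-- The Tyshkevich composition.  The vertices of Sp come first, followed
-- by those of G, so the order of the vertices is (K, S, V(G)).

module _ {k s n : ℕ} (Sp : SplitGraph k s) (G : Graph n) where
  private
    module Sp = SplitGraph Sp
    module G = Graph G

  CompositionAdj : Rel (Fin (k ℕ.+ s) ⊎ Fin n) 0ℓ
  CompositionAdj (inj₁ u) (inj₁ v) = Sp.Adj u v
  CompositionAdj (inj₁ u) (inj₂ y) = Sp.InK u
  CompositionAdj (inj₂ x) (inj₁ v) = Sp.InK v
  CompositionAdj (inj₂ x) (inj₂ y) = G.Adj x y

  private
    adj? : Decidable CompositionAdj
    adj? (inj₁ u) (inj₁ v) = Sp.adj? u v
    adj? (inj₁ u) (inj₂ y) = Fin.any? λ i → u Fin.≟ (i ↑ˡ s)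
    adj? (inj₂ x) (inj₁ v) = Fin.any? λ i → v Fin.≟ (i ↑ˡ s)
    adj? (inj₂ x) (inj₂ y) = G.adj? x y

    symm : Symmetric CompositionAdj
    symm {inj₁ u} {inj₁ v} = Sp.symm
    symm {inj₁ u} {inj₂ y} p = p
    symm {inj₂ x} {inj₁ v} p = p
    symm {inj₂ x} {inj₂ y} = G.symm

    irrefl : Irreflexive _≡_ CompositionAdj
    irrefl {inj₁ u} refl = Sp.irrefl refl
    irrefl {inj₂ x} refl = G.irrefl refl

  infixl 7 _∘_

  _∘_ : Graph ((k ℕ.+ s) ℕ.+ n)
  _∘_ = record
    { Adj    = λ u v → CompositionAdj (splitAt (k ℕ.+ s) u) (splitAt (k ℕ.+ s) v)
    ; adj?   = λ u v → adj? (splitAt (k ℕ.+ s) u) (splitAt (k ℕ.+ s) v)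
    ; symm   = λ {u v} → symm {splitAt (k ℕ.+ s) u} {splitAt (k ℕ.+ s) v}
    ; irrefl = λ { {u} refl → irrefl {splitAt (k ℕ.+ s) u} refl }
    }

module LinearAlgebra {c ℓ : Level} (F : CommutativeRing c ℓ) where
  private module F = CommutativeRing F
  open VecEquality F.setoid public using (_≋_)
  open RawMonoidDefs F.+-rawMonoid public using (sum)

  Vec : ℕ → Set c
  Vec = Vector F.Carrier

  Matrix : ℕ → ℕ → Set c
  Matrix m n = Vector (Vec n) m

  𝟎 : ∀ {n} → Vec n
  𝟎 = replicate _ F.0#

  infixr 7 _·_ _·ᵛ_

  _·ᵛ_ : ∀ {m n} → Matrix m n → Vec n → Vec m
  (A ·ᵛ x) i = sum λ j → A i j F.* x j

  _·_ : ∀ {m n p} → Matrix m n → Matrix n p → Matrix m p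
  (A · B) i j = sum λ l → A i l F.* B l j

  𝟏 : ∀ {n} → Matrix n n
  𝟏 i j = if does (i Fin.≟ j) then F.1# else F.0#

  𝒩 : ∀ {m n} → Matrix m n → Pred (Vec n) ℓ
  𝒩 A x = A ·ᵛ x ≋ 𝟎

  Zero : ∀ {n} → Pred (Vec n) ℓ
  Zero x = x ≋ 𝟎

  Invertible : ∀ {n} → Matrix n n → Set _
  Invertible {n} A = ∃[ B ] (∀ i → (A · B) i ≋ 𝟏 i) × (∀ i → (B · A) i ≋ 𝟏 i)

  Singular : ∀ {n} → Matrix n n → Set _
  Singular A = ¬ Invertible A

  adjacencyMatrix : ∀ {n} → Graph n → Matrix n n
  adjacencyMatrix G u v = if does (Graph.adj? G u v) then F.1# else F.0#

  biadjacencyMatrix : ∀ {k s} → SplitGraph k s → Matrix k s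
  biadjacencyMatrix {k} {s} Sp u v =
    if does (SplitGraph.adj? Sp (u ↑ˡ s) (k ↑ʳ v)) then F.1# else F.0#

open LinearAlgebra ℝ-commutativeRing public

{-# OPTIONS --safe #-}
-- On vectors (0, z, 0) supported on S, only the K-rows of the adjacency
-- matrix of Sp ∘ G act nontrivially: S is independent and no vertex of
-- S is adjacent to V(G).  The K-rows act on z as R does.  A matrix with
-- a left inverse has trivial nullspace, which gives singularity.

module Submission where

open import Algebra.Bundles using (CommutativeRing)
import Algebra.Properties.Semiring.Sum as SemiringSum
open import Data.Bool.Base using (if_then_else_)
open import Data.Fin.Base using (Fin; zero; suc; splitAt; _↑ˡ_; _↑ʳ_)
open import Data.Fin.Properties using (splitAt-↑ˡ; splitAt-↑ʳ; join-splitAt)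
open import Data.Nat.Base as ℕ using (ℕ)
open import Data.Product.Base using (∃-syntax; _×_; _,_)
open import Data.Sum.Base using (inj₁; inj₂)
open import Data.Vec.Functional using (_++_)
open import Data.Vec.Functional.Properties using (lookup-++ˡ; lookup-++ʳ)
open import Function.Bundles using (_⇔_; mk⇔)
open import Relation.Binary.PropositionalEquality as ≡ using (_≡_)
open import Relation.Nullary using (¬_)
open import Relation.Nullary.Decidable using (dec-false; does-⇔)
open import Relation.Unary using (_∈_; _⊆_; _⊇_; _≐_)

open import Defs using (module LinearAlgebra)

↑ʳ≢↑ˡ : ∀ {m n} {i : Fin m} {j : Fin n} → ¬ (m ↑ʳ j ≡ i ↑ˡ n)
↑ʳ≢↑ˡ {m} {n} {i} {j} eq
  with () ← ≡.trans (≡.sym (splitAt-↑ʳ m n j)) (≡.trans (≡.cong (splitAt m) eq) (splitAt-↑ˡ m i n))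

↑-elim : ∀ {p} m {n} (P : Fin (m ℕ.+ n) → Set p) →
         (∀ i → P (i ↑ˡ n)) → (∀ j → P (m ↑ʳ j)) → ∀ v → P v
-- Once `splitAt m v` is abstracted, `join-splitAt` equates a block index with `v`, so matching on
-- `refl` puts `v` itself in the form `left` or `right` expects.
↑-elim m {n} P left right v with splitAt m v in eq | join-splitAt m n v
... | inj₁ i | ≡.refl = left i
... | inj₂ j | ≡.refl = right j

module Nullspaces {c ℓ} (F : CommutativeRing c ℓ) where
  open CommutativeRing F hiding (zero)
  open LinearAlgebra F
  open SemiringSum semiring
    using (sum-cong-≋; sum-replicate-zero; ∑-comm; *-distribˡ-sum; *-distribʳ-sum)
  open import Relation.Binary.Reasoning.Setoid setoid

  sum-zero : ∀ {n} {f : Vec n} → f ≋ 𝟎 → sum f ≈ 0#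
  sum-zero {n} f≋0 = trans (sum-cong-≋ f≋0) (sum-replicate-zero n)

  sum-↑ : ∀ m {n} (f : Vec (m ℕ.+ n)) →
          sum f ≈ sum (λ i → f (i ↑ˡ n)) + sum (λ j → f (m ↑ʳ j))
  sum-↑ ℕ.zero    f = sym (+-identityˡ _)
  sum-↑ (ℕ.suc m) f = trans (+-congˡ (sum-↑ m (λ i → f (suc i)))) (sym (+-assoc _ _ _))

  ·ᵛ-congʳ : ∀ {m n} (A : Matrix m n) {x y : Vec n} → x ≋ y → A ·ᵛ x ≋ A ·ᵛ y
  ·ᵛ-congʳ A x≋y i = sum-cong-≋ λ j → *-congˡ (x≋y j)

  ·ᵛ-zeroʳ : ∀ {m n} (A : Matrix m n) {x : Vec n} → x ≋ 𝟎 → A ·ᵛ x ≋ 𝟎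
  ·ᵛ-zeroʳ A x≋0 i = sum-zero λ j → trans (*-congˡ (x≋0 j)) (zeroʳ (A i j))

  ·ᵛ-++ : ∀ {m p q} (A : Matrix m (p ℕ.+ q)) (x : Vec p) (y : Vec q) i →
          (A ·ᵛ (x ++ y)) i ≈ sum (λ j → A i (j ↑ˡ q) * x j) + sum (λ j → A i (p ↑ʳ j) * y j)
  ·ᵛ-++ {p = p} {q} A x y i = trans (sum-↑ p (λ j → A i j * (x ++ y) j)) (+-cong
    (sum-cong-≋ λ j → *-congˡ (reflexive (lookup-++ˡ x y j)))
    (sum-cong-≋ λ j → *-congˡ (reflexive (lookup-++ʳ x y j))))

  ·ᵛ-assoc : ∀ {m n p} (B : Matrix m n) (A : Matrix n p) (x : Vec p) →
             (B · A) ·ᵛ x ≋ B ·ᵛ (A ·ᵛ x)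
  ·ᵛ-assoc B A x i = begin
    sum (λ j → sum (λ l → B i l * A l j) * x j)
      ≈⟨ sum-cong-≋ (λ j → *-distribʳ-sum (x j) (λ l → B i l * A l j)) ⟩
    sum (λ j → sum (λ l → B i l * A l j * x j))
      ≈⟨ ∑-comm (λ j l → B i l * A l j * x j) ⟩
    sum (λ l → sum (λ j → B i l * A l j * x j))
      ≈⟨ sum-cong-≋ (λ l → sum-cong-≋ λ j → *-assoc (B i l) (A l j) (x j)) ⟩
    sum (λ l → sum (λ j → B i l * (A l j * x j)))
      ≈⟨ sum-cong-≋ (λ l → *-distribˡ-sum (B i l) (λ j → A l j * x j)) ⟨
    sum (λ l → B i l * sum (λ j → A l j * x j)) ∎

  𝟏-·ᵛ : ∀ {n} (x : Vec n) → 𝟏 ·ᵛ x ≋ x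
  𝟏-·ᵛ x zero = trans
    (+-cong (*-identityˡ (x zero)) (sum-zero λ j → zeroˡ (x (suc j))))
    (+-identityʳ (x zero))
  -- `suc i ≟ suc j` has the same Boolean as `i ≟ j`, so past its leading zero this row is row `i`
  -- of the smaller identity.
  𝟏-·ᵛ x (suc i) = trans
    (+-cong (zeroˡ (x zero)) (𝟏-·ᵛ (λ j → x (suc j)) i))
    (+-identityˡ (x (suc i)))

  invertible⇒𝒩⊆Zero : ∀ {n} {A : Matrix n n} → Invertible A → 𝒩 A ⊆ Zero
  invertible⇒𝒩⊆Zero {A = A} (B , _ , BA≋𝟏) {x} Ax≋0 i = begin
    x i               ≈⟨ 𝟏-·ᵛ x i ⟨
    (𝟏 ·ᵛ x) i        ≈⟨ sum-cong-≋ (λ j → *-congʳ (BA≋𝟏 i j)) ⟨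
    ((B · A) ·ᵛ x) i  ≈⟨ ·ᵛ-assoc B A x i ⟩
    (B ·ᵛ A ·ᵛ x) i   ≈⟨ ·ᵛ-zeroʳ B Ax≋0 i ⟩
    0#                ∎

  -- Only columns indexed by S are constrained, because a vector (0, z, 0) meets no others with a
  -- nonzero coefficient. This is all that the linear algebra needs to know of the composition.
  record SColumns {k s n : ℕ} (A : Matrix (k ℕ.+ s ℕ.+ n) (k ℕ.+ s ℕ.+ n)) (R : Matrix k s) : Set c
    where
    field
      K-rows : ∀ i j → A ((i ↑ˡ s) ↑ˡ n) ((k ↑ʳ j) ↑ˡ n) ≡ R i j
      S-rows : ∀ i j → A ((k ↑ʳ i) ↑ˡ n) ((k ↑ʳ j) ↑ˡ n) ≡ 0#
      G-rows : ∀ y j → A ((k ℕ.+ s) ↑ʳ y) ((k ↑ʳ j) ↑ˡ n) ≡ 0#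

  module _ {k s n : ℕ} {A : Matrix (k ℕ.+ s ℕ.+ n) (k ℕ.+ s ℕ.+ n)} {R : Matrix k s}
           (columns : SColumns A R) where
    open SColumns columns

    embedS : Vec s → Vec (k ℕ.+ s ℕ.+ n)
    embedS z = (𝟎 {k} ++ z) ++ 𝟎 {n}

    embedS-S : ∀ z j → embedS z ((k ↑ʳ j) ↑ˡ n) ≡ z j
    embedS-S z j = ≡.trans (lookup-++ˡ (𝟎 {k} ++ z) (𝟎 {n}) (k ↑ʳ j)) (lookup-++ʳ (𝟎 {k}) z j)

    ·ᵛ-embedS : ∀ z u → (A ·ᵛ embedS z) u ≈ sum (λ j → A u ((k ↑ʳ j) ↑ˡ n) * z j)
    ·ᵛ-embedS z u = begin
      (A ·ᵛ embedS z) u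
        ≈⟨ ·ᵛ-++ A (𝟎 {k} ++ z) (𝟎 {n}) u ⟩
      (A-Sp ·ᵛ (𝟎 {k} ++ z)) u + sum (λ y → A u ((k ℕ.+ s) ↑ʳ y) * 0#)
        ≈⟨ +-cong (·ᵛ-++ A-Sp (𝟎 {k}) z u) (·ᵛ-zeroʳ A-G {𝟎} (λ _ → refl) u) ⟩
      sum (λ i → A-Sp u (i ↑ˡ s) * 0#) + sum (λ j → A-Sp u (k ↑ʳ j) * z j) + 0#
        ≈⟨ +-identityʳ _ ⟩
      sum (λ i → A-Sp u (i ↑ˡ s) * 0#) + sum (λ j → A-Sp u (k ↑ʳ j) * z j)
        ≈⟨ +-congʳ (·ᵛ-zeroʳ A-K {𝟎} (λ _ → refl) u) ⟩
      0# + sum (λ j → A-Sp u (k ↑ʳ j) * z j)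
        ≈⟨ +-identityˡ _ ⟩
      sum (λ j → A-Sp u (k ↑ʳ j) * z j) ∎
      where
      -- Column blocks of `A`, matching the nesting of `embedS`: V(G) is split off first, then K
      -- from S.
      A-Sp : Matrix (k ℕ.+ s ℕ.+ n) (k ℕ.+ s)
      A-Sp v w = A v (w ↑ˡ n)

      A-G : Matrix (k ℕ.+ s ℕ.+ n) n
      A-G v y = A v ((k ℕ.+ s) ↑ʳ y)

      A-K : Matrix (k ℕ.+ s ℕ.+ n) k
      A-K v i = A v ((i ↑ˡ s) ↑ˡ n)

    embedS-∈-𝒩 : ∀ z → z ∈ 𝒩 R → embedS z ∈ 𝒩 A
    embedS-∈-𝒩 z Rz≋0 u = trans (·ᵛ-embedS z u) (↑-elim (k ℕ.+ s) P (↑-elim k _ K-row S-row) G-row u)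
      where
      P : Fin (k ℕ.+ s ℕ.+ n) → Set ℓ
      P v = sum (λ j → A v ((k ↑ʳ j) ↑ˡ n) * z j) ≈ 0#

      K-row : ∀ i → P ((i ↑ˡ s) ↑ˡ n)
      K-row i = trans
        (sum-cong-≋ λ j → *-congʳ (reflexive (K-rows i j)))
        (Rz≋0 i)

      zero-row : ∀ v → (∀ j → A v ((k ↑ʳ j) ↑ˡ n) ≡ 0#) → P v
      zero-row v Av≡0 = sum-zero λ j → trans (*-congʳ (reflexive (Av≡0 j))) (zeroˡ (z j))

      S-row : ∀ i → P ((k ↑ʳ i) ↑ˡ n)
      S-row i = zero-row _ (S-rows i)

      G-row : ∀ y → P ((k ℕ.+ s) ↑ʳ y)
      G-row y = zero-row _ (G-rows y)

    -- Vectors are compared only up to `≋`, so membership in `𝒩 A` has to be carried from `embedS z`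
    -- to every `x` equal to it.
    𝒩-⊇-embedS : 𝒩 A ⊇ (λ x → ∃[ z ] z ∈ 𝒩 R × x ≋ embedS z)
    𝒩-⊇-embedS (z , Rz≋0 , x≋) u = trans (·ᵛ-congʳ A x≋ u) (embedS-∈-𝒩 z Rz≋0 u)

    -- By contraposition, so no nonzero witness has to be extracted: if `A` is invertible then
    -- `embedS z` vanishes for each `z` in `𝒩 R`, and its S-coordinates are those of `z`.
    𝒩≢Zero⇒singular : ¬ (𝒩 R ≐ Zero) → Singular A
    𝒩≢Zero⇒singular 𝒩R≢0 invertible = 𝒩R≢0 (𝒩R⊆Zero , ·ᵛ-zeroʳ R)
      where
      𝒩R⊆Zero : 𝒩 R ⊆ Zero
      𝒩R⊆Zero {z} Rz≋0 j = trans
        (reflexive (≡.sym (embedS-S z j)))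
        (invertible⇒𝒩⊆Zero invertible (embedS-∈-𝒩 z Rz≋0) ((k ↑ʳ j) ↑ˡ n))

open import Defs
open Nullspaces ℝ-commutativeRing

adjacencyMatrix-¬Adj : ∀ {n} (G : Graph n) {u v} → ¬ Graph.Adj G u v → adjacencyMatrix G u v ≡ 0ᴿ
adjacencyMatrix-¬Adj G {u} {v} ¬adj =
  ≡.cong (if_then 1ᴿ else 0ᴿ) (dec-false (Graph.adj? G u v) ¬adj)

module _ {k s n : ℕ} (Sp : SplitGraph k s) (G : Graph n) where
  private module Sp = SplitGraph Sp

  Adj-∘-K-S : ∀ i j → Graph.Adj (Sp ∘ G) ((i ↑ˡ s) ↑ˡ n) ((k ↑ʳ j) ↑ˡ n) ⇔ Sp.Adj (i ↑ˡ s) (k ↑ʳ j)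
  Adj-∘-K-S i j
    -- With both `splitAt`s evaluated, adjacency in the composition computes to adjacency in `Sp`.
    rewrite splitAt-↑ˡ (k ℕ.+ s) (i ↑ˡ s) n | splitAt-↑ˡ (k ℕ.+ s) (k ↑ʳ j) n =
    mk⇔ (λ p → p) (λ p → p)

  ¬Adj-∘-S-S : ∀ i j → ¬ Graph.Adj (Sp ∘ G) ((k ↑ʳ i) ↑ˡ n) ((k ↑ʳ j) ↑ˡ n)
  ¬Adj-∘-S-S i j
    rewrite splitAt-↑ˡ (k ℕ.+ s) (k ↑ʳ i) n | splitAt-↑ˡ (k ℕ.+ s) (k ↑ʳ j) n =
    Sp.independent i j

  -- Adjacency to a vertex of `G` amounts to membership in K, and no `k ↑ʳ j` has the form `i ↑ˡ s`.
  ¬Adj-∘-G-S : ∀ y j → ¬ Graph.Adj (Sp ∘ G) ((k ℕ.+ s) ↑ʳ y) ((k ↑ʳ j) ↑ˡ n)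
  ¬Adj-∘-G-S y j
    rewrite splitAt-↑ʳ (k ℕ.+ s) n y | splitAt-↑ˡ (k ℕ.+ s) (k ↑ʳ j) n =
    λ (_ , eq) → ↑ʳ≢↑ˡ eq

  ∘-SColumns : SColumns (adjacencyMatrix (Sp ∘ G)) (biadjacencyMatrix Sp)
  ∘-SColumns = record
    -- The two entries come from different decision procedures; equivalence of the decided
    -- propositions makes their Booleans agree.
    { K-rows = λ i j → ≡.cong (if_then 1ᴿ else 0ᴿ)
        (does-⇔ (Adj-∘-K-S i j) (Graph.adj? (Sp ∘ G) _ _) (Sp.adj? _ _))
    ; S-rows = λ i j → adjacencyMatrix-¬Adj (Sp ∘ G) (¬Adj-∘-S-S i j)
    ; G-rows = λ y j → adjacencyMatrix-¬Adj (Sp ∘ G) (¬Adj-∘-G-S y j)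
    }

-- Instantiating F = ℝ must happen while A and R are variables: with the
-- concrete matrices, conversion unfolds into the Cauchy proofs of ℝ.
SColumns⇒𝒩-⊇×singular : ∀ {k s n} {A : Matrix (k ℕ.+ s ℕ.+ n) (k ℕ.+ s ℕ.+ n)} {R : Matrix k s} →
    SColumns A R →
    (𝒩 A ⊇ (λ x → ∃[ z ] z ∈ 𝒩 R × x ≋ ((𝟎 {k} ++ z) ++ 𝟎 {n})))
    × (¬ (𝒩 R ≐ Zero) → Singular A)
SColumns⇒𝒩-⊇×singular {A = A} {R} columns =
  (λ {x} → 𝒩-⊇-embedS {A = A} {R} columns {x}) , 𝒩≢Zero⇒singular {A = A} {R} columns

theorem7p1 : ∀ {k s n : ℕ} (Sp : SplitGraph k s) (G : Graph n) →
    (𝒩 (adjacencyMatrix (Sp ∘ G)) ⊇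
    (λ x → ∃[ z ] z ∈ 𝒩 (biadjacencyMatrix Sp) × x ≋ ((𝟎 {k} ++ z) ++ 𝟎 {n})))
    × (¬ (𝒩 (biadjacencyMatrix Sp) ≐ Zero) → Singular (adjacencyMatrix (Sp ∘ G)))
theorem7p1 Sp G = SColumns⇒𝒩-⊇×singular (∘-SColumns Sp G)
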